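{- For all $L,h\in\mathbb{Z}$, $$p(L,h)=\begin{cases}0&\text{if }L<0\text{ or }(L=0\text{ and }h\ne0),\\ 1&\text{if }L\ge0\text{ and }(h=0\text{ or }h=L),\\ p(L,h\bmod L)&\text{if }L>0\text{ and }(h<0\text{ or }h>L),\\ p(L-h-1,h)+p(h-1,L-1)&\text{otherwise.}\end{cases}$$
   Context: For a finite word $w$ over $\{0,1\}$, $|w|$ is its length and $|w|_0,|w|_1$ are its numbers of $0$'s and $1$'s; $|w|_1$ is the height of $w$. A subword means a contiguous factor. A word $w$ is balanced if for all finite subwords $u,v$ of $w$ with $|u|=|v|$ one has $\bigl||u|_0-|v|_0\bigr|\le 1$. For $0\le h\le L$, $\mathbb{P}(L,h)$ is the set of balanced palindromes in $\{0,1\}^*$ of length $L$ and height $h$. The function $p:\mathbb{Z}^2\to\mathbb{N}$ is defined by $p(L,h)=\#\mathbb{P}(L,h\bmod L)$ if $L>0$ (with $h\bmod L\in\{0,\dots,L-1\}$), $p(0,0)=1$, and $p(L,h)=0$ if $L<0$ or if $L=0$ and $h\ne0$. -}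

module Defs where

open import Data.Fin.Base using (Fin)
open import Data.Fin.Patterns using (0F; 1F)
import Data.Fin.Properties as Fin
open import Data.Integer.Base using (ℤ; +_; -[1+_]; +[1+_]; _%ℕ_)
open import Data.List.Base
  using (List; []; _∷_; _++_; map; length; filter; reverse; allFin; cartesianProductWith)
open import Data.List.Membership.Propositional using (_∈_)
open import Data.List.Membership.Propositional.Properties
  using (∈-map⁺; ∈-map⁻; ∈-++⁺ˡ; ∈-++⁺ʳ; ∈-++⁻; ∈-allFin; ∈-cartesianProductWith⁺)
open import Data.List.Properties using (≡-dec; ∷-injective)
open import Data.List.Relation.Binary.Infix.Heterogeneous using (Infix; here; there)
open import Data.List.Relation.Binary.Prefix.Heterogeneous using (Prefix; []; _∷_)
open import Data.List.Relation.Unary.All as All using (all?)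
open import Data.List.Relation.Unary.Any using (here; there)
open import Data.List.Relation.Unary.Unique.Propositional using (Unique; []; _∷_)
open import Data.List.Relation.Unary.Unique.Propositional.Properties
  using (allFin⁺; cartesianProductWith⁺)
open import Data.Nat.Base using (ℕ; zero; suc; _≤_; ∣_-_∣)
import Data.Nat.Properties as ℕ
open import Data.Product.Base using (_×_; _,_)
open import Data.Sum.Base using (inj₁; inj₂)
open import Relation.Binary.PropositionalEquality using (_≡_; refl)
open import Relation.Nullary.Decidable using (Dec; map′; _×-dec_; _→-dec_)
open import Relation.Unary using (Decidable)

Word : Set
Word = List (Fin 2)

∣_∣₀ : Word → ℕ
∣ w ∣₀ = length (filter (Fin._≟ 0F) w)

∣_∣₁ : Word → ℕ
∣ w ∣₁ = length (filter (Fin._≟ 1F) w)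

height : Word → ℕ
height = ∣_∣₁

infix 4 _IsSubwordOf_

_IsSubwordOf_ : Word → Word → Set
u IsSubwordOf w = Infix _≡_ u w

Balanced : Word → Set
Balanced w = ∀ u v → u IsSubwordOf w → v IsSubwordOf w →
             length u ≡ length v → ∣ ∣ u ∣₀ - ∣ v ∣₀ ∣ ≤ 1

Palindrome : Word → Set
Palindrome w = reverse w ≡ w

ℙ : ℕ → ℕ → Word → Set
ℙ L h w = Balanced w × Palindrome w × length w ≡ L × height w ≡ h

prefixes : Word → List Word
prefixes []       = [] ∷ []
prefixes (x ∷ xs) = [] ∷ map (x ∷_) (prefixes xs)

subwords : Word → List Word
subwords []       = [] ∷ []
subwords (x ∷ xs) = prefixes (x ∷ xs) ++ subwords xs

∈-prefixes⁺ : ∀ {u w} → Prefix _≡_ u w → u ∈ prefixes w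
∈-prefixes⁺ {w = []}    []         = here refl
∈-prefixes⁺ {w = _ ∷ _} []         = here refl
∈-prefixes⁺             (refl ∷ p) = there (∈-map⁺ _ (∈-prefixes⁺ p))

∈-prefixes⁻ : ∀ {u} w → u ∈ prefixes w → Prefix _≡_ u w
∈-prefixes⁻ []       (here refl) = []
∈-prefixes⁻ (x ∷ xs) (here refl) = []
∈-prefixes⁻ (x ∷ xs) (there u∈) with ∈-map⁻ (x ∷_) u∈
... | _ , v∈ , refl = refl ∷ ∈-prefixes⁻ xs v∈

∈-subwords⁺ : ∀ {u w} → u IsSubwordOf w → u ∈ subwords w
∈-subwords⁺ {w = []}     (here [])  = here refl
∈-subwords⁺ {w = _ ∷ _}  (here p)   = ∈-++⁺ˡ (∈-prefixes⁺ p)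
∈-subwords⁺ {w = x ∷ xs} (there i)  = ∈-++⁺ʳ (prefixes (x ∷ xs)) (∈-subwords⁺ i)

∈-subwords⁻ : ∀ {u} w → u ∈ subwords w → u IsSubwordOf w
∈-subwords⁻ []       (here refl) = here []
∈-subwords⁻ (x ∷ xs) u∈ with ∈-++⁻ (prefixes (x ∷ xs)) u∈
... | inj₁ u∈p = here (∈-prefixes⁻ (x ∷ xs) u∈p)
... | inj₂ u∈s = there (∈-subwords⁻ xs u∈s)

balanced? : Decidable Balanced
balanced? w = map′
  (λ ok u v u⊑w v⊑w → All.lookup (All.lookup ok (∈-subwords⁺ u⊑w)) (∈-subwords⁺ v⊑w))
  (λ bal → All.tabulate λ {u} u∈ → All.tabulate λ {v} v∈ →
     bal u v (∈-subwords⁻ w u∈) (∈-subwords⁻ w v∈))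
  (all? (λ u → all? (λ v → (length u ℕ.≟ length v) →-dec (∣ ∣ u ∣₀ - ∣ v ∣₀ ∣ ℕ.≤? 1))
                    (subwords w))
        (subwords w))

ℙ? : ∀ L h → Decidable (ℙ L h)
ℙ? L h w = balanced? w ×-dec ≡-dec Fin._≟_ (reverse w) w
           ×-dec (length w ℕ.≟ L) ×-dec (height w ℕ.≟ h)

words : ℕ → List Word
words zero    = [] ∷ []
words (suc n) = cartesianProductWith _∷_ (allFin 2) (words n)

-- Together these say that filtering words L counts each word of length L once.
∈-words : ∀ w → w ∈ words (length w)
∈-words []       = here refl
∈-words (x ∷ xs) = ∈-cartesianProductWith⁺ _∷_ (∈-allFin x) (∈-words xs)

words-unique : ∀ n → Unique (words n)
words-unique zero    = All.[] ∷ []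
words-unique (suc n) = cartesianProductWith⁺ _∷_ ∷-injective (allFin⁺ 2) (words-unique n)

#ℙ : ℕ → ℕ → ℕ
#ℙ L h = length (filter (ℙ? L h) (words L))

p : ℤ → ℤ → ℕ
p +[1+ n ] h        = #ℙ (suc n) (h %ℕ suc n)
p (+ zero) (+ zero) = 1
p (+ zero) _        = 0
p -[1+ _ ] _        = 0

{-# OPTIONS --safe #-}
module Submission where

-- A palindrome starting with 0 has the form 0 1^a₁ 0 1^a₂ 0 … 1^aₙ 0.  It is balanced iff a is a
-- balanced sequence of naturals, i.e. the sums of factors of a of equal length differ by at most 1:
-- in a word, compare the factors that contain, resp. are covered by, m consecutive blocks.  The
-- entries of a balanced sequence of length n and sum s lie in {q , q + 1} with q = s / n, so
-- subtracting q turns the balanced palindromic ones into ℙ(n , s mod n).  Since n + 1 and s are the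
-- numbers of 0's and 1's, the palindromes starting with 0 number p(L - h - 1 , h).  Exchanging 0
-- and 1, those starting with 1 number p(h - 1 , L - h) = p(h - 1 , L - 1).

open import Data.Fin.Base as Fin using (Fin; toℕ)
open import Data.Fin.Patterns using (0F; 1F)
import Data.Fin.Properties as Fin
import Data.Integer.Base as ℤ
open import Data.Integer.Base using (ℤ; +_; -[1+_]; 0ℤ; 1ℤ; _-_; _<_; _>_; _≥_; _%_; >-nonZero;
  +<+; -<+; +≤+)
open import Data.Integer.DivMod using (n%ℕd<d)
import Data.Integer.Tactic.RingSolver as ℤ-Solver
open import Data.List.Base
  using (List; []; _∷_; _++_; _∷ʳ_; [_]; map; length; filter; reverse; replicate; take)
open import Data.List.Membership.Propositional using (_∈_)
open import Data.List.Membership.Propositional.Properties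
  using (∈-filter⁺; ∈-filter⁻; ∈-map⁺; ∈-map⁻; ∈-++⁺ˡ; ∈-++⁺ʳ; ∈-++⁻)
open import Data.List.Membership.Propositional.Properties.WithK using (unique∧set⇒bag)
open import Data.List.Properties
  using (∷-injective; map-injective; length-map; length-take; length-replicate;
         unfold-reverse; reverse-map; map-∘; map-id; map-cong; ++-assoc;
         ++-identityʳ; length-++)
open import Data.List.Relation.Binary.BagAndSetEquality using (∼bag⇒↭)
open import Data.List.Relation.Binary.Infix.Heterogeneous as Infix using (Infix; here; there)
open import Data.List.Relation.Binary.Infix.Heterogeneous.Properties as Infix
  using (Prefix-Infix-trans)
open import Data.List.Relation.Binary.Permutation.Propositional.Properties using (↭-length)
open import Data.List.Relation.Binary.Prefix.Heterogeneous using (Prefix; []; _∷_)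
import Data.List.Relation.Binary.Prefix.Heterogeneous.Properties as Prefix
open import Data.List.Relation.Unary.All as All using (All; []; _∷_)
open import Data.List.Relation.Unary.Any using (here; there)
open import Data.List.Relation.Unary.Unique.Propositional using (Unique; []; _∷_)
import Data.List.Relation.Unary.Unique.Propositional.Properties as Unique
import Data.Nat.Base as ℕ
open import Data.Nat.Base
  using (ℕ; zero; suc; _+_; _*_; _/_; _≤_; s≤s; z≤n; ∣_-_∣) renaming (_<_ to _<ℕ_; _%_ to _%ℕ_)
open import Data.Nat.DivMod
  using (m≡m%n+[m/n]*n; m/n*n≤m; m<n⇒m%n≡m; m%n<n; n%n≡0; [m+n]%n≡m%n)
open import Data.Nat.ListAction using (sum)
open import Data.Nat.Properties
open import Data.Nat.Tactic.RingSolver using (solve-∀)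
open import Data.Product.Base using (_×_; proj₁; proj₂; _,_; ∃₂; ∃-syntax)
open import Data.Sum.Base using (_⊎_; inj₁; inj₂)
open import Function.Base using (_∘_; id)
open import Function.Bundles using (_⇔_; mk⇔; Equivalence)
open import Relation.Binary.Definitions using (tri<; tri≈; tri>)
open import Relation.Binary.PropositionalEquality
  using (_≡_; _≢_; refl; sym; trans; cong; cong₂; subst; subst₂; module ≡-Reasoning)
open import Relation.Nullary.Decidable using (yes; no)
open import Relation.Nullary.Negation using (¬_; contradiction)
open import Defs

private variable
  A B : Set

-- Balancedness as a one-sided bound.

-- One inequality suffices because `u` and `v` may be exchanged. The measure `f` is a parameter so
-- that zeros, ones and sums of naturals are treated alike.
BalancedBy : (List A → ℕ) → List A → Set
BalancedBy f w = ∀ {u v} → Infix _≡_ u w → Infix _≡_ v w → length u ≡ length v → f u ≤ suc (f v)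

-- Between factors of equal length, an excess in `g` is an equal deficit in `f`, so the bound for
-- `g` on `u`, `v` is the one for `f` on `v`, `u`.
BalancedBy-complement : {f g : List A → ℕ} → (∀ u → f u + g u ≡ length u) →
                        ∀ {w} → BalancedBy f w → BalancedBy g w
BalancedBy-complement {f = f} {g} f+g bal {u} {v} u⊑w v⊑w eq = +-cancelˡ-≤ (f u) _ _ (begin
  f u + g u        ≡⟨ f+g u ⟩
  length u         ≡⟨ eq ⟩
  length v         ≡⟨ f+g v ⟨
  f v + g v        ≤⟨ +-monoˡ-≤ (g v) (bal v⊑w u⊑w (sym eq)) ⟩
  suc (f u) + g v  ≡⟨ +-suc (f u) (g v) ⟨
  f u + suc (g v)  ∎)
  where open ≤-Reasoning

Balanced⇒By₀ : ∀ {w} → Balanced w → BalancedBy ∣_∣₀ w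
Balanced⇒By₀ bal {u} {v} u⊑w v⊑w eq = begin
  ∣ u ∣₀                         ≤⟨ m≤n+∣m-n∣ ∣ u ∣₀ ∣ v ∣₀ ⟩
  ∣ v ∣₀ + ∣ ∣ u ∣₀ - ∣ v ∣₀ ∣   ≤⟨ +-monoʳ-≤ ∣ v ∣₀ (bal u v u⊑w v⊑w eq) ⟩
  ∣ v ∣₀ + 1                     ≡⟨ +-comm ∣ v ∣₀ 1 ⟩
  suc ∣ v ∣₀                     ∎
  where open ≤-Reasoning

By₀⇒Balanced : ∀ {w} → BalancedBy ∣_∣₀ w → Balanced w
By₀⇒Balanced bal u v u⊑w v⊑w eq with ∣m-n∣≡[m∸n]∨[n∸m] ∣ u ∣₀ ∣ v ∣₀
... | inj₁ d = subst (_≤ 1) (sym d)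
  (m≤n+o⇒m∸n≤o ∣ u ∣₀ ∣ v ∣₀ (subst (∣ u ∣₀ ≤_) (+-comm 1 ∣ v ∣₀) (bal u⊑w v⊑w eq)))
... | inj₂ d = subst (_≤ 1) (sym d)
  (m≤n+o⇒m∸n≤o ∣ v ∣₀ ∣ u ∣₀ (subst (∣ v ∣₀ ≤_) (+-comm 1 ∣ u ∣₀) (bal v⊑w u⊑w (sym eq))))

∣w∣₀+∣w∣₁≡length : ∀ w → ∣ w ∣₀ + ∣ w ∣₁ ≡ length w
∣w∣₀+∣w∣₁≡length []       = refl
∣w∣₀+∣w∣₁≡length (0F ∷ w) = cong suc (∣w∣₀+∣w∣₁≡length w)
∣w∣₀+∣w∣₁≡length (1F ∷ w) = trans (+-suc ∣ w ∣₀ ∣ w ∣₁) (cong suc (∣w∣₀+∣w∣₁≡length w))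

∣w∣₁+∣w∣₀≡length : ∀ w → ∣ w ∣₁ + ∣ w ∣₀ ≡ length w
∣w∣₁+∣w∣₀≡length w = trans (+-comm ∣ w ∣₁ ∣ w ∣₀) (∣w∣₀+∣w∣₁≡length w)

Balanced⇒By₁ : ∀ {w} → Balanced w → BalancedBy ∣_∣₁ w
Balanced⇒By₁ = BalancedBy-complement ∣w∣₀+∣w∣₁≡length ∘ Balanced⇒By₀

By₁⇒Balanced : ∀ {w} → BalancedBy ∣_∣₁ w → Balanced w
By₁⇒Balanced = By₀⇒Balanced ∘ BalancedBy-complement ∣w∣₁+∣w∣₀≡length

-- Prefixes and factors.

Prefix-refl : (w : List A) → Prefix _≡_ w w
Prefix-refl []      = []
Prefix-refl (x ∷ w) = refl ∷ Prefix-refl w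

take-Prefix : ∀ n (w : List A) → Prefix _≡_ (take n w) w
take-Prefix zero    w       = []
take-Prefix (suc n) []      = []
take-Prefix (suc n) (x ∷ w) = refl ∷ take-Prefix n w

∈⇒Infix : ∀ {x : A} {w} → x ∈ w → Infix _≡_ [ x ] w
∈⇒Infix (here refl) = here (refl ∷ [])
∈⇒Infix (there x∈w) = there (∈⇒Infix x∈w)

Prefix-map⁻ : ∀ (f : A → B) {x} w → Prefix _≡_ x (map f w) → ∃[ u ] Prefix _≡_ u w × x ≡ map f u
Prefix-map⁻ f []      []         = [] , [] , refl
Prefix-map⁻ f (y ∷ w) []         = [] , [] , refl
Prefix-map⁻ f (y ∷ w) (refl ∷ p) with u , u≼w , refl ← Prefix-map⁻ f w p = y ∷ u , refl ∷ u≼w , refl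

Infix-map⁻ : ∀ (f : A → B) {x} w → Infix _≡_ x (map f w) → ∃[ u ] Infix _≡_ u w × x ≡ map f u
Infix-map⁻ f []      (here [])  = [] , here [] , refl
Infix-map⁻ f (y ∷ w) (here p)  with u , u≼w , eq ← Prefix-map⁻ f (y ∷ w) p = u , here u≼w , eq
Infix-map⁻ f (y ∷ w) (there i) with u , u⊑w , eq ← Infix-map⁻ f w i  = u , there u⊑w , eq

Infix-map⁺ : ∀ (f : A → B) {u w} → Infix _≡_ u w → Infix _≡_ (map f u) (map f w)
Infix-map⁺ f = Infix.map⁺ f f ∘ Infix.map (cong f)

Prefix⇒∣∣₀≤ : ∀ {u w} → Prefix _≡_ u w → ∣ u ∣₀ ≤ ∣ w ∣₀
Prefix⇒∣∣₀≤ = Prefix.length-mono ∘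
  Prefix.filter⁺ (Fin._≟ 0F) (Fin._≟ 0F) (λ { refl → id }) (λ { refl → id })

Infix⇒∣∣₁≤ : ∀ {u w} → Infix _≡_ u w → ∣ u ∣₁ ≤ ∣ w ∣₁
Infix⇒∣∣₁≤ (here p) = Prefix.length-mono
  (Prefix.filter⁺ (Fin._≟ 1F) (Fin._≟ 1F) (λ { refl → id }) (λ { refl → id }) p)
Infix⇒∣∣₁≤ {w = x ∷ w} (there i) = ≤-trans (Infix⇒∣∣₁≤ i) (height-∷ x)
  where
  height-∷ : ∀ x → ∣ w ∣₁ ≤ ∣ x ∷ w ∣₁
  height-∷ 0F = ≤-refl
  height-∷ 1F = n≤1+n _

-- Encoding words by their blocks of ones.

-- run k (a₁ ∷ … ∷ aₙ) is 1ᵏ 0 1^a₁ 0 … 1^aₙ 0, and core omits its last 0.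
run : ℕ → List ℕ → Word
run zero    []      = 0F ∷ []
run zero    (b ∷ a) = 0F ∷ run b a
run (suc k) a       = 1F ∷ run k a

core : ℕ → List ℕ → Word
core zero    []      = []
core zero    (b ∷ a) = 0F ∷ core b a
core (suc k) a       = 1F ∷ core k a

∣run∣₀ : ∀ k a → ∣ run k a ∣₀ ≡ suc (length a)
∣run∣₀ zero    []      = refl
∣run∣₀ zero    (b ∷ a) = cong suc (∣run∣₀ b a)
∣run∣₀ (suc k) a       = ∣run∣₀ k a

∣run∣₁ : ∀ k a → ∣ run k a ∣₁ ≡ k + sum a
∣run∣₁ zero    []      = refl
∣run∣₁ zero    (b ∷ a) = ∣run∣₁ b a
∣run∣₁ (suc k) a       = cong suc (∣run∣₁ k a)

length-run : ∀ k a → length (run k a) ≡ suc (length a) + (k + sum a)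
length-run k a = trans (sym (∣w∣₀+∣w∣₁≡length (run k a))) (cong₂ _+_ (∣run∣₀ k a) (∣run∣₁ k a))

∣core∣₀ : ∀ k a → ∣ core k a ∣₀ ≡ length a
∣core∣₀ zero    []      = refl
∣core∣₀ zero    (b ∷ a) = cong suc (∣core∣₀ b a)
∣core∣₀ (suc k) a       = ∣core∣₀ k a

length-core : ∀ k a → length (core k a) ≡ length a + (k + sum a)
length-core zero    []      = refl
length-core zero    (b ∷ a) = cong suc (length-core b a)
length-core (suc k) a       = trans (cong suc (length-core k a)) (sym (+-suc (length a) (k + sum a)))

core≼run : ∀ k a → Prefix _≡_ (core k a) (run k a)
core≼run zero    []      = []
core≼run zero    (b ∷ a) = refl ∷ core≼run b a
core≼run (suc k) a       = refl ∷ core≼run k a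

run≢[] : ∀ k a → run k a ≢ []
run≢[] zero    []      ()
run≢[] zero    (_ ∷ _) ()
run≢[] (suc _) _       ()

run-injective : ∀ k a l b → run k a ≡ run l b → k ≡ l × a ≡ b
run-injective zero    []      zero    []      eq = refl , refl
run-injective zero    []      zero    (y ∷ b) eq =
  contradiction (sym (proj₂ (∷-injective eq))) (run≢[] y b)
run-injective zero    (x ∷ a) zero    []      eq =
  contradiction (proj₂ (∷-injective eq)) (run≢[] x a)
run-injective zero    (x ∷ a) zero    (y ∷ b) eq
  with refl , refl ← run-injective x a y b (proj₂ (∷-injective eq)) = refl , refl
run-injective (suc k) a       (suc l) b       eq
  with refl , refl ← run-injective k a l b (proj₂ (∷-injective eq)) = refl , refl
run-injective zero    []      (suc l) b       ()
run-injective zero    (x ∷ a) (suc l) b       ()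
run-injective (suc k) a       zero    []      ()
run-injective (suc k) a       zero    (y ∷ b) ()

run₀-injective : ∀ {a b} → run 0 a ≡ run 0 b → a ≡ b
run₀-injective eq = proj₂ (run-injective 0 _ 0 _ eq)

-- Prepending `0F` turns the leading ones into a new first block, and prepending `1F` lengthens the
-- leading run; the final `0F` closes the last block.
run-surjective : ∀ w → ∃₂ λ k a → w ∷ʳ 0F ≡ run k a
run-surjective []       = 0 , [] , refl
run-surjective (0F ∷ w) with k , a , eq ← run-surjective w = 0     , k ∷ a , cong (0F ∷_) eq
run-surjective (1F ∷ w) with k , a , eq ← run-surjective w = suc k , a     , cong (1F ∷_) eq

run-∷ʳ : ∀ k a b → run k (a ∷ʳ b) ≡ (run k a ++ replicate b 1F) ∷ʳ 0F
run-∷ʳ zero    []      b = cong (0F ∷_) (run-[] b)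
  where
  run-[] : ∀ b → run b [] ≡ replicate b 1F ∷ʳ 0F
  run-[] zero    = refl
  run-[] (suc b) = cong (1F ∷_) (run-[] b)
run-∷ʳ zero    (c ∷ a) b = cong (0F ∷_) (run-∷ʳ c a b)
run-∷ʳ (suc k) a       b = cong (1F ∷_) (run-∷ʳ k a b)

replicate-∷ʳ : ∀ n (x : A) → replicate n x ∷ʳ x ≡ replicate (suc n) x
replicate-∷ʳ zero    x = refl
replicate-∷ʳ (suc n) x = cong (x ∷_) (replicate-∷ʳ n x)

-- The `k` leading ones become trailing ones, and the next `0F` to be moved to the end closes them
-- into a last block. Only `k = 0` is needed later, but the induction passes through every `k`.
reverse-run : ∀ k a → reverse (run k a) ≡ run 0 (reverse a) ++ replicate k 1F
reverse-run zero    []      = refl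
reverse-run zero    (b ∷ a) = begin
  reverse (0F ∷ run b a)                        ≡⟨ unfold-reverse 0F (run b a) ⟩
  reverse (run b a) ∷ʳ 0F                       ≡⟨ cong (_∷ʳ 0F) (reverse-run b a) ⟩
  (run 0 (reverse a) ++ replicate b 1F) ∷ʳ 0F   ≡⟨ run-∷ʳ 0 (reverse a) b ⟨
  run 0 (reverse a ∷ʳ b)                        ≡⟨ cong (run 0) (unfold-reverse b a) ⟨
  run 0 (reverse (b ∷ a))                       ≡⟨ ++-identityʳ _ ⟨
  run 0 (reverse (b ∷ a)) ++ []                 ∎
  where
  open ≡-Reasoning
reverse-run (suc k) a = begin
  reverse (1F ∷ run k a)                        ≡⟨ unfold-reverse 1F (run k a) ⟩
  reverse (run k a) ∷ʳ 1F                       ≡⟨ cong (_∷ʳ 1F) (reverse-run k a) ⟩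
  (run 0 (reverse a) ++ replicate k 1F) ∷ʳ 1F   ≡⟨ ++-assoc (run 0 (reverse a)) _ _ ⟩
  run 0 (reverse a) ++ (replicate k 1F ∷ʳ 1F)   ≡⟨ cong (run 0 (reverse a) ++_) (replicate-∷ʳ k 1F) ⟩
  run 0 (reverse a) ++ replicate (suc k) 1F     ∎
  where open ≡-Reasoning

reverse-run₀ : ∀ a → reverse (run 0 a) ≡ run 0 (reverse a)
reverse-run₀ a = trans (reverse-run 0 a) (++-identityʳ _)

run-Prefix : ∀ k {x a} → Prefix _≡_ x a → Prefix _≡_ (run k x) (run k a)
run-Prefix (suc k) p                   = refl ∷ run-Prefix k p
run-Prefix zero    {a = []}    []      = refl ∷ []
run-Prefix zero    {a = _ ∷ _} []      = refl ∷ []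
run-Prefix zero    (refl ∷ p)          = refl ∷ run-Prefix _ p

-- The occurrence starts at the zero just before the first block of `x`, so leading ones are
-- skipped.
run-Infix : ∀ k {x a} → Infix _≡_ x a → Infix _≡_ (run 0 x) (run k a)
run-Infix (suc k) i         = there (run-Infix k i)
run-Infix zero    (here p)  = here (run-Prefix 0 p)
run-Infix zero    (there i) = there (run-Infix _ i)

Infix-tail : ∀ {x : A} {u w} → Infix _≡_ (x ∷ u) w → Infix _≡_ u w
Infix-tail (here (_ ∷ p)) = there (here p)
Infix-tail (there i)      = there (Infix-tail i)

-- Balanced words and balanced block sequences.

-- Let two factors of `m` blocks have sums differing by 2 or more. The smaller one with both
-- bounding zeros has `m + 1` zeros, the larger one without them only `m - 1`, yet the latter is at
-- least as long. Cutting it to equal length contradicts balance.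
run-BalancedBy⁻ : ∀ {a} → BalancedBy ∣_∣₀ (run 0 a) → BalancedBy sum a
run-BalancedBy⁻ bal {[]}    {y} x⊑a y⊑a eq = z≤n
run-BalancedBy⁻ bal {b ∷ x} {y} x⊑a y⊑a eq = ≮⇒≥ λ gap →
  let t = take (length (run 0 y)) (core b x)
      t≼core = take-Prefix (length (run 0 y)) (core b x)
      -- `run 0 (b ∷ x)` is `0F ∷ run b x`, so dropping its two outer zeros leaves `core b x`.
      t⊑run = Prefix-Infix-trans trans (Prefix.trans trans t≼core (core≼run b x))
                (Infix-tail (run-Infix 0 x⊑a))
      run≤core : length (run 0 y) ≤ length (core b x)
      run≤core = begin
        length (run 0 y)                      ≡⟨ length-run 0 y ⟩
        suc (length y) + sum y                ≡⟨ cong (λ m → suc m + sum y) eq ⟨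
        suc (suc (length x)) + sum y          ≡⟨ lemma (length x) (sum y) ⟩
        length x + suc (suc (sum y))          ≤⟨ +-monoʳ-≤ (length x) gap ⟩
        length x + (b + sum x)                ≡⟨ length-core b x ⟨
        length (core b x)                     ∎
      ∣t∣ : length (run 0 y) ≡ length t
      ∣t∣ = sym (trans (length-take (length (run 0 y)) (core b x)) (m≤n⇒m⊓n≡m run≤core))
  in <-irrefl refl (begin-strict
       suc (length x)             ≡⟨ eq ⟩
       length y                   <⟨ ≤-refl ⟩
       suc (length y)             ≡⟨ ∣run∣₀ 0 y ⟨
       ∣ run 0 y ∣₀               ≤⟨ bal (run-Infix 0 y⊑a) t⊑run ∣t∣ ⟩
       suc ∣ t ∣₀                 ≤⟨ s≤s (Prefix⇒∣∣₀≤ t≼core) ⟩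
       suc ∣ core b x ∣₀          ≡⟨ cong suc (∣core∣₀ b x) ⟩
       suc (length x)             ∎)
  where
  open ≤-Reasoning
  lemma : ∀ m n → suc (suc m) + n ≡ m + suc (suc n)
  lemma = solve-∀

-- A factor with m + 1 zeros contains m complete blocks.
inner-Prefix : ∀ k a m {u} → Prefix _≡_ u (run k a) → suc m ≤ ∣ u ∣₀ →
               ∃[ y ] Prefix _≡_ y a × length y ≡ m × k + sum y ≤ ∣ u ∣₁
inner-Prefix (suc k) a       m       (refl ∷ p) m<  with y , y≼a , eq , le ← inner-Prefix k a m p m< =
  y , y≼a , eq , s≤s le
inner-Prefix zero    a       zero    p          m<  = [] , [] , refl , z≤n
inner-Prefix zero    []      (suc m) (refl ∷ []) (s≤s ())
inner-Prefix zero    (b ∷ a) (suc m) (refl ∷ p) (s≤s m<)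
  with y , y≼a , eq , le ← inner-Prefix b a m p m< = b ∷ y , refl ∷ y≼a , cong suc eq , le

inner-Infix : ∀ k a m {u} → Infix _≡_ u (run k a) → suc m ≤ ∣ u ∣₀ →
              ∃[ y ] Infix _≡_ y a × length y ≡ m × sum y ≤ ∣ u ∣₁
inner-Infix (suc k) a       m (there i) m< = inner-Infix k a m i m<
inner-Infix zero    []      m (there (here [])) ()
inner-Infix zero    (b ∷ a) m (there i) m< with y , y⊑a , eq , le ← inner-Infix b a m i m< =
  y , there y⊑a , eq , le
inner-Infix k a m (here p) m< with y , y≼a , eq , le ← inner-Prefix k a m p m< =
  y , here y≼a , eq , ≤-trans (m≤n+m (sum y) k) le

-- A factor with m zeros meets at most m + 1 blocks; the first one is cut short in run k a.
outer-Prefix : ∀ k a m {v} → Prefix _≡_ v (run k a) → ∣ v ∣₀ ≤ m → m ≤ length a →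
               ∃[ y ] Prefix _≡_ y a × length y ≡ m × ∣ v ∣₁ ≤ k + sum y
outer-Prefix (suc k) a       m       (refl ∷ p) le ma
  with y , y≼a , eq , le′ ← outer-Prefix k a m p le ma = y , y≼a , eq , s≤s le′
outer-Prefix zero    (b ∷ a) (suc m) (refl ∷ p) (s≤s le) (s≤s ma)
  with y , y≼a , eq , le′ ← outer-Prefix b a m p le ma = b ∷ y , refl ∷ y≼a , cong suc eq , le′
outer-Prefix zero    []      (suc m) (refl ∷ p) le ()
outer-Prefix zero    []      zero    (refl ∷ p) () ma
outer-Prefix zero    (b ∷ a) zero    (refl ∷ p) () ma
outer-Prefix k       a       m       []         le ma =
  take m a , take-Prefix m a , trans (length-take m a) (m≤n⇒m⊓n≡m ma) , z≤n

-- Here `b` is the full length of the block whose last `k` ones begin `run k a`; counting that block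
-- whole only increases the sum.
outer-Infix : ∀ k b a m {v} → k ≤ b → Infix _≡_ v (run k a) → ∣ v ∣₀ ≤ m → m ≤ length a →
              ∃[ y ] Infix _≡_ y (b ∷ a) × length y ≡ suc m × ∣ v ∣₁ ≤ sum y
outer-Infix (suc k) b a       m k≤b (there i) le ma = outer-Infix k b a m (<⇒≤ k≤b) i le ma
outer-Infix zero    b []      m k≤b (there (here [])) le z≤n =
  b ∷ [] , here (refl ∷ []) , refl , z≤n
outer-Infix zero    b (c ∷ a) m {v} k≤b (there i) le ma with m ≤? length a
... | yes m≤ with y , y⊑ , eq , le′ ← outer-Infix c c a m ≤-refl i le m≤ = y , there y⊑ , eq , le′
-- Now `m` is the length of `c ∷ a`, so the required `m + 1` blocks are all of `b ∷ c ∷ a`, whose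
-- sum bounds every height.
... | no m≰ = b ∷ c ∷ a , here (Prefix-refl _) , cong suc (≤-antisym (≰⇒> m≰) ma) , (begin
  ∣ v ∣₁             ≤⟨ Infix⇒∣∣₁≤ i ⟩
  ∣ run c a ∣₁       ≡⟨ ∣run∣₁ c a ⟩
  c + sum a          ≤⟨ m≤n+m _ b ⟩
  b + (c + sum a)    ∎)
  where open ≤-Reasoning
outer-Infix k       b a       m k≤b (here p)  le ma
  with y , y≼a , eq , le′ ← outer-Prefix k a m p le ma =
  b ∷ y , here (refl ∷ y≼a) , cong suc eq , ≤-trans le′ (+-monoˡ-≤ (sum y) k≤b)

-- No block precedes the first 0 of run 0 a, so a prefix is covered by starting at the first block.
outer-Infix₀ : ∀ a {v} → Infix _≡_ v (run 0 a) → suc ∣ v ∣₀ ≤ length a →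
               ∃[ y ] Infix _≡_ y a × length y ≡ suc ∣ v ∣₀ × ∣ v ∣₁ ≤ sum y
outer-Infix₀ (b ∷ a) (there i)         (s≤s le) = outer-Infix b b a _ ≤-refl i ≤-refl le
outer-Infix₀ (b ∷ a) (here [])         (s≤s le) = b ∷ [] , here (refl ∷ []) , refl , z≤n
outer-Infix₀ (b ∷ a) (here (refl ∷ p)) (s≤s le)
  with y , y≼a , eq , le′ ← outer-Prefix b a _ p (n≤1+n _) le =
  b ∷ y , here (refl ∷ y≼a) , cong suc eq , le′

-- If `u` had at least two more zeros than `v`, it would contain `∣ v ∣₀ + 1` whole blocks, while as
-- many blocks cover `v`. Balance of `a` then gives `v` at most one more 1 than `u`, so `v` would be
-- shorter than `u`.
run-BalancedBy⁺ : ∀ {a} → BalancedBy sum a → BalancedBy ∣_∣₀ (run 0 a)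
run-BalancedBy⁺ {a} bal {u} {v} u⊑w v⊑w eq = ≮⇒≥ λ gap →
  let x , x⊑a , ∣x∣ , sumx = inner-Infix 0 a (suc ∣ v ∣₀) u⊑w gap
      -- The factor `x` found inside `u` shows that `a` has enough blocks to cover `v`.
      y , y⊑a , ∣y∣ , sumy = outer-Infix₀ a v⊑w (subst (_≤ length a) ∣x∣ (Infix.length-mono x⊑a))
  in <-irrefl refl (begin-strict
       length v                     ≡⟨ ∣w∣₀+∣w∣₁≡length v ⟨
       ∣ v ∣₀ + ∣ v ∣₁              ≤⟨ +-monoʳ-≤ ∣ v ∣₀ (≤-trans sumy (bal y⊑a x⊑a (trans ∣y∣ (sym ∣x∣)))) ⟩
       ∣ v ∣₀ + suc (sum x)         ≡⟨ +-suc ∣ v ∣₀ (sum x) ⟩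
       suc ∣ v ∣₀ + sum x           <⟨ +-mono-<-≤ gap sumx ⟩
       ∣ u ∣₀ + ∣ u ∣₁              ≡⟨ ∣w∣₀+∣w∣₁≡length u ⟩
       length u                     ≡⟨ eq ⟩
       length v                     ∎)
  where open ≤-Reasoning

-- Adding a constant to the letters of a binary word.

shift : ℕ → Word → List ℕ
shift q = map (λ x → q + toℕ x)

shift-injective : ∀ q {u v} → shift q u ≡ shift q v → u ≡ v
shift-injective q = map-injective (λ {x} {y} eq → Fin.toℕ-injective (+-cancelˡ-≡ q (toℕ x) (toℕ y) eq))

sum-shift : ∀ q w → sum (shift q w) ≡ height w + q * length w
sum-shift q []       = sym (*-zeroʳ q)
sum-shift q (0F ∷ w) = trans (cong (_+_ (q + 0)) (sum-shift q w)) (lemma q (height w) (length w))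
  where
  lemma : ∀ q h l → (q + 0) + (h + q * l) ≡ h + q * suc l
  lemma = solve-∀
sum-shift q (1F ∷ w) = trans (cong (_+_ (q + 1)) (sum-shift q w)) (lemma q (height w) (length w))
  where
  lemma : ∀ q h l → (q + 1) + (h + q * l) ≡ suc h + q * suc l
  lemma = solve-∀

-- Factors of equal length all gain the same amount, so sums differ exactly as heights do.
shift-BalancedBy⁺ : ∀ q {w} → BalancedBy ∣_∣₁ w → BalancedBy sum (shift q w)
shift-BalancedBy⁺ q {w} bal x⊑ y⊑ eq
  with u , u⊑w , refl ← Infix-map⁻ (λ i → q + toℕ i) w x⊑
     | v , v⊑w , refl ← Infix-map⁻ (λ i → q + toℕ i) w y⊑ = begin
  sum (shift q u)                  ≡⟨ sum-shift q u ⟩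
  height u + q * length u          ≡⟨ cong (λ l → height u + q * l) ∣u∣≡∣v∣ ⟩
  height u + q * length v          ≤⟨ +-monoˡ-≤ (q * length v) (bal u⊑w v⊑w ∣u∣≡∣v∣) ⟩
  suc (height v + q * length v)    ≡⟨ cong suc (sum-shift q v) ⟨
  suc (sum (shift q v))            ∎
  where
  open ≤-Reasoning
  ∣u∣≡∣v∣ : length u ≡ length v
  ∣u∣≡∣v∣ = trans (sym (length-map _ u)) (trans eq (length-map _ v))

shift-BalancedBy⁻ : ∀ q {w} → BalancedBy sum (shift q w) → BalancedBy ∣_∣₁ w
shift-BalancedBy⁻ q {w} bal {u} {v} u⊑w v⊑w eq = +-cancelʳ-≤ (q * length v) _ _ (begin
  height u + q * length v          ≡⟨ cong (λ l → height u + q * l) eq ⟨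
  height u + q * length u          ≡⟨ sum-shift q u ⟨
  sum (shift q u)                  ≤⟨ bal (Infix-map⁺ _ u⊑w) (Infix-map⁺ _ v⊑w)
                                       (trans (length-map _ u) (trans eq (sym (length-map _ v)))) ⟩
  suc (sum (shift q v))            ≡⟨ cong suc (sum-shift q v) ⟩
  suc (height v + q * length v)    ∎)
  where open ≤-Reasoning

-- Entries of a balanced sequence compared with its mean.

sum≤ : ∀ {c a} → All (_≤ c) a → sum a ≤ length a * c
sum≤ []         = z≤n
sum≤ (x≤ ∷ a≤)  = +-mono-≤ x≤ (sum≤ a≤)

sum≥ : ∀ {c a} → All (c ≤_) a → length a * c ≤ sum a
sum≥ []         = z≤n
sum≥ (x≥ ∷ a≥)  = +-mono-≤ x≥ (sum≥ a≥)

sum< : ∀ {c a x} → All (_≤ c) a → x ∈ a → x <ℕ c → sum a <ℕ length a * c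
sum< (x≤ ∷ a≤) (here refl) x<c = +-mono-<-≤ x<c (sum≤ a≤)
sum< (x≤ ∷ a≤) (there x∈a) x<c = +-mono-≤-< x≤ (sum< a≤ x∈a x<c)

shift-surjective : ∀ q {a} → All (λ x → q ≤ x × x ≤ suc q) a → ∃[ w ] a ≡ shift q w
shift-surjective q []                   = [] , refl
shift-surjective q {x ∷ a} ((q≤ , ≤1+q) ∷ all) with w , refl ← shift-surjective q all | x ≟ q
... | yes refl = 0F ∷ w , cong (_∷ shift q w) (sym (+-identityʳ q))
... | no x≢q   = 1F ∷ w , cong (_∷ shift q w) (trans (≤-antisym ≤1+q (≤∧≢⇒< q≤ (x≢q ∘ sym))) (+-comm 1 q))

-- Balance is applied to the factors of length one.
entries : ∀ {a} → BalancedBy sum a → ∀ {x y} → x ∈ a → y ∈ a → x ≤ suc y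
entries bal {x} {y} x∈a y∈a = subst₂ _≤_ (+-identityʳ x) (cong suc (+-identityʳ y))
  (bal (∈⇒Infix x∈a) (∈⇒Infix y∈a) refl)

-- An entry below `q` forces all entries to be at most `q`, making the sum less than `q * length a`.
-- An entry above `q + 1` forces all to be at least `q + 1`, making the sum too large.
mean-bounds : ∀ q {a} → BalancedBy sum a → q * length a ≤ sum a → sum a <ℕ suc q * length a →
              All (λ x → q ≤ x × x ≤ suc q) a
mean-bounds q {a} bal lo hi = All.tabulate λ {x} x∈a →
    (≮⇒≥ λ x<q → ≤⇒≯ lo (subst (sum a <ℕ_) (*-comm (length a) q)
      (sum< (All.tabulate λ y∈a → ≤-trans (entries bal y∈a x∈a) x<q) x∈a x<q)))
  , (≮⇒≥ λ q+1<x → ≤⇒≯ (subst (_≤ sum a) (*-comm (length a) (suc q))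
      (sum≥ (All.tabulate λ y∈a → ℕ.s≤s⁻¹ (≤-trans q+1<x (entries bal x∈a y∈a))))) hi)

-- Enumerating balanced palindromic sequences.

BalancedPalindrome : ℕ → ℕ → List ℕ → Set
BalancedPalindrome n s a = BalancedBy sum a × reverse a ≡ a × length a ≡ n × sum a ≡ s

∈-filter-words : ∀ L h w → w ∈ filter (ℙ? L h) (words L) ⇔ ℙ L h w
∈-filter-words L h w = mk⇔ (proj₂ ∘ ∈-filter⁻ (ℙ? L h) {xs = words L})
  λ { w∈ℙ@(_ , _ , refl , _) → ∈-filter⁺ (ℙ? L h) (∈-words w) w∈ℙ }

-- Duplicate-free lists with the same members are permutations of each other, so any such
-- enumeration gives the count.
#ℙ≡length : ∀ L h {ws} → Unique ws → (∀ w → w ∈ ws ⇔ ℙ L h w) → #ℙ L h ≡ length ws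
#ℙ≡length L h {ws} uniq mem = ↭-length (∼bag⇒↭ (unique∧set⇒bag (Unique.filter⁺ (ℙ? L h) (words-unique L)) uniq
  λ {w} → mk⇔ (Equivalence.from (mem w) ∘ Equivalence.to (∈-filter-words L h w))
              (Equivalence.from (∈-filter-words L h w) ∘ Equivalence.to (mem w))))

shift-BalancedPalindrome⁺ : ∀ n s → let r = s %ℕ suc n ; q = s / suc n in
  ∀ {w} → ℙ (suc n) r w → BalancedPalindrome (suc n) s (shift q w)
shift-BalancedPalindrome⁺ n s {w} (bal , pal , len , ht) =
    shift-BalancedBy⁺ q (Balanced⇒By₁ bal)
  , trans (sym (reverse-map _ w)) (cong (shift q) pal)
  , trans (length-map _ w) len
  , trans (sum-shift q w) (trans (cong₂ (λ h l → h + q * l) ht len) (sym (m≡m%n+[m/n]*n s (suc n))))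
  where
  q = s / suc n

-- Division with remainder puts the sum between `q` and `q + 1` times the length, so the entries are
-- `q` or `q + 1`; cancelling the multiple of `q` leaves the remainder as height.
shift-BalancedPalindrome⁻ : ∀ n s → let r = s %ℕ suc n ; q = s / suc n in
  ∀ {a} → BalancedPalindrome (suc n) s a → ∃[ w ] ℙ (suc n) r w × a ≡ shift q w
shift-BalancedPalindrome⁻ n s {a} (bal , pal , len , Σa) = unshift (shift-surjective q bounds) bal pal len Σa
  where
  q = s / suc n
  r = s %ℕ suc n

  s<[1+q]n : s <ℕ suc q * suc n
  s<[1+q]n = subst (_<ℕ suc q * suc n) (sym (m≡m%n+[m/n]*n s (suc n)))
    (+-monoˡ-< (q * suc n) (m%n<n s (suc n)))

  bounds : All (λ x → q ≤ x × x ≤ suc q) a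
  bounds = mean-bounds q bal
    (subst₂ (λ l t → q * l ≤ t) (sym len) (sym Σa) (m/n*n≤m s (suc n)))
    (subst₂ (λ l t → t <ℕ suc q * l) (sym len) (sym Σa) s<[1+q]n)

  unshift : ∃[ w ] a ≡ shift q w → BalancedBy sum a → reverse a ≡ a → length a ≡ suc n → sum a ≡ s →
            ∃[ w ] ℙ (suc n) r w × a ≡ shift q w
  unshift (w , refl) bal pal len Σa = w ,
    ( By₁⇒Balanced (shift-BalancedBy⁻ q bal)
    , shift-injective q (trans (reverse-map _ w) pal)
    , ∣w∣
    , +-cancelʳ-≡ (q * suc n) _ _ (begin
        height w + q * suc n      ≡⟨ cong (λ l → height w + q * l) ∣w∣ ⟨
        height w + q * length w   ≡⟨ sum-shift q w ⟨
        sum (shift q w)           ≡⟨ Σa ⟩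
        s                         ≡⟨ m≡m%n+[m/n]*n s (suc n) ⟩
        r + q * suc n             ∎)
    ) , refl
    where
    open ≡-Reasoning
    ∣w∣ = trans (sym (length-map _ w)) len

-- For positive `n`, shifting by the quotient is a bijection from the words counted by `p`. For
-- `n = 0` only the empty sequence exists, with sum 0, in agreement with the convention for `p` at
-- length 0.
balancedPalindromes : ∀ n s → ∃[ as ] Unique as × length as ≡ p (+ n) (+ s) ×
                      (∀ a → a ∈ as ⇔ BalancedPalindrome n s a)
balancedPalindromes zero zero = [ [] ] , [] ∷ [] , refl , λ a → mk⇔
  (λ { (here refl) → (λ { (here []) _ _ → z≤n }) , refl , refl , refl })
  (λ { (_ , _ , ∣a∣ , _) → here (nil a ∣a∣) })
  where
  nil : ∀ a → length a ≡ 0 → a ≡ []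
  nil [] refl = refl
balancedPalindromes zero (suc s) = [] , [] , refl , λ a → mk⇔ (λ ()) (λ { (_ , _ , ∣a∣ , Σa) → none a ∣a∣ Σa })
  where
  none : ∀ a → length a ≡ 0 → sum a ≡ suc s → a ∈ []
  none [] _ ()
balancedPalindromes (suc n) s =
    map (shift q) ws
  , Unique.map⁺ (shift-injective q) (Unique.filter⁺ (ℙ? (suc n) r) (words-unique (suc n)))
  , length-map (shift q) ws
  , λ a → mk⇔ to from
  where
  q = s / suc n
  r = s %ℕ suc n
  ws = filter (ℙ? (suc n) r) (words (suc n))

  to : ∀ {a} → a ∈ map (shift q) ws → BalancedPalindrome (suc n) s a
  to a∈ with w , w∈ , refl ← ∈-map⁻ (shift q) a∈ =
    shift-BalancedPalindrome⁺ n s (Equivalence.to (∈-filter-words (suc n) r w) w∈)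

  from : ∀ {a} → BalancedPalindrome (suc n) s a → a ∈ map (shift q) ws
  from bp with w , w∈ℙ , refl ← shift-BalancedPalindrome⁻ n s bp =
    ∈-map⁺ (shift q) (Equivalence.from (∈-filter-words (suc n) r w) w∈ℙ)

-- Palindromes starting with 0.

run-ℙ : ∀ {n s a} → BalancedPalindrome n s a → ℙ (suc (n + s)) s (run 0 a)
run-ℙ {a = a} (bal , pal , refl , refl) =
    By₀⇒Balanced (run-BalancedBy⁺ bal)
  , trans (reverse-run₀ a) (cong (run 0) pal)
  , length-run 0 a
  , ∣run∣₁ 0 a

-- A palindrome starting with `0F` also ends with it and so decodes as some `run k a`; its first
-- letter forces `k = 0`. Injectivity of `run 0` makes `a` a palindrome.
ℙ-run : ∀ {n s w} → ℙ (suc (n + s)) s (0F ∷ w) → ∃[ a ] BalancedPalindrome n s a × 0F ∷ w ≡ run 0 a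
ℙ-run {n} {s} {w} (bal , pal , len , ht) = decode (run-surjective (reverse w))
  where
  0w≡ : 0F ∷ w ≡ reverse w ∷ʳ 0F
  0w≡ = trans (sym pal) (unfold-reverse 0F w)

  decode : (∃₂ λ k a → reverse w ∷ʳ 0F ≡ run k a) → ∃[ a ] BalancedPalindrome n s a × 0F ∷ w ≡ run 0 a
  decode (suc k , a , eq) = contradiction (trans 0w≡ eq) λ ()
  decode (zero  , a , eq) = a ,
    ( run-BalancedBy⁻ (Balanced⇒By₀ (subst Balanced 0w≡run bal))
    , run₀-injective (trans (sym (reverse-run₀ a)) (subst Palindrome 0w≡run pal))
    , +-cancelʳ-≡ s _ _ (suc-injective (begin
        suc (length a) + s         ≡⟨ cong (_+_ (suc (length a))) Σa ⟨
        suc (length a) + sum a     ≡⟨ length-run 0 a ⟨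
        length (run 0 a)           ≡⟨ cong length 0w≡run ⟨
        suc (length w)             ≡⟨ len ⟩
        suc (n + s)                ∎))
    , Σa ) , 0w≡run
    where
    open ≡-Reasoning
    0w≡run : 0F ∷ w ≡ run 0 a
    0w≡run = trans 0w≡ eq
    Σa : sum a ≡ s
    Σa = trans (sym (∣run∣₁ 0 a)) (trans (sym (cong height 0w≡run)) ht)

-- Exchanging the two letters.

complement : Word → Word
complement = map Fin.opposite

complement-involutive : ∀ w → complement (complement w) ≡ w
complement-involutive w = trans (sym (map-∘ w)) (trans (map-cong Fin.opposite-involutive w) (map-id w))

complement-injective : ∀ {u v} → complement u ≡ complement v → u ≡ v
complement-injective {u} {v} eq =
  trans (sym (complement-involutive u)) (trans (cong complement eq) (complement-involutive v))

∣complement∣₀ : ∀ w → ∣ complement w ∣₀ ≡ ∣ w ∣₁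
∣complement∣₀ []       = refl
∣complement∣₀ (0F ∷ w) = ∣complement∣₀ w
∣complement∣₀ (1F ∷ w) = cong suc (∣complement∣₀ w)

∣complement∣₁ : ∀ w → ∣ complement w ∣₁ ≡ ∣ w ∣₀
∣complement∣₁ w = trans (sym (∣complement∣₀ (complement w))) (cong ∣_∣₀ (complement-involutive w))

-- The numbers `z` of zeros and `h` of ones trade places, and balance can be measured on either
-- letter.
complement-ℙ : ∀ {z h w} → ℙ (z + h) h w → ℙ (h + z) z (complement w)
complement-ℙ {z} {h} {w} (bal , pal , len , ht) =
    By₀⇒Balanced bal′
  , trans (sym (reverse-map Fin.opposite w)) (cong complement pal)
  , trans (length-map _ w) (trans len (+-comm z h))
  , trans (∣complement∣₁ w) (+-cancelʳ-≡ h _ _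
      (trans (cong (_+_ ∣ w ∣₀) (sym ht)) (trans (∣w∣₀+∣w∣₁≡length w) len)))
  where
  bal′ : BalancedBy ∣_∣₀ (complement w)
  bal′ x⊑ y⊑ eq with u , u⊑w , refl ← Infix-map⁻ Fin.opposite w x⊑
                   | v , v⊑w , refl ← Infix-map⁻ Fin.opposite w y⊑ =
    subst₂ (λ i j → i ≤ suc j) (sym (∣complement∣₀ u)) (sym (∣complement∣₀ v))
      (Balanced⇒By₁ bal u⊑w v⊑w (trans (sym (length-map _ u)) (trans eq (length-map _ v))))

-- The recurrence and the height 0 case.

-- The words have `n + 1` zeros and `m + 1` ones. Those starting with 0 encode `n` blocks of sum
-- `m + 1`; the complements of those starting with 1 encode `m` blocks of sum `n + 1`.
#ℙ-recurrence : ∀ n m → #ℙ (suc n + suc m) (suc m) ≡ p (+ n) (+ suc m) + p (+ m) (+ suc n)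
#ℙ-recurrence n m
  with as , as-unique , ∣as∣ , ∈as ← balancedPalindromes n (suc m)
     | bs , bs-unique , ∣bs∣ , ∈bs ← balancedPalindromes m (suc n) = begin
  #ℙ (suc n + suc m) (suc m)             ≡⟨ #ℙ≡length _ _ unique (λ w → mk⇔ to (from w)) ⟩
  length (map f as ++ map g bs)          ≡⟨ length-++ (map f as) ⟩
  length (map f as) + length (map g bs)  ≡⟨ cong₂ _+_ (length-map f as) (length-map g bs) ⟩
  length as + length bs                  ≡⟨ cong₂ _+_ ∣as∣ ∣bs∣ ⟩
  p (+ n) (+ suc m) + p (+ m) (+ suc n)  ∎
  where
  open ≡-Reasoning
  f g : List ℕ → Word
  f = run 0
  g = complement ∘ run 0

  f≢g : ∀ a b → f a ≢ g b
  f≢g []      []      ()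
  f≢g []      (_ ∷ _) ()
  f≢g (_ ∷ _) []      ()
  f≢g (_ ∷ _) (_ ∷ _) ()

  unique : Unique (map f as ++ map g bs)
  unique = Unique.++⁺ (Unique.map⁺ run₀-injective as-unique)
    (Unique.map⁺ (run₀-injective ∘ complement-injective) bs-unique)
    λ { (w∈f , w∈g) → disjoint (∈-map⁻ f w∈f) (∈-map⁻ g w∈g) }
    where
    disjoint : ∀ {w} → ∃[ a ] a ∈ as × w ≡ f a → ¬ (∃[ b ] b ∈ bs × w ≡ g b)
    disjoint (a , _ , refl) (b , _ , eq) = f≢g a b eq

  to : ∀ {w} → w ∈ map f as ++ map g bs → ℙ (suc n + suc m) (suc m) w
  to w∈ with ∈-++⁻ (map f as) w∈
  ... | inj₁ w∈f with a , a∈ , refl ← ∈-map⁻ f w∈f = run-ℙ (Equivalence.to (∈as a) a∈)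
  ... | inj₂ w∈g with b , b∈ , refl ← ∈-map⁻ g w∈g =
    complement-ℙ {suc m} {suc n} (run-ℙ (Equivalence.to (∈bs b) b∈))

  from : ∀ w → ℙ (suc n + suc m) (suc m) w → w ∈ map f as ++ map g bs
  from []       (_ , _ , () , _)
  from (0F ∷ w) w∈ℙ with a , bp , eq ← ℙ-run {n} {suc m} w∈ℙ =
    ∈-++⁺ˡ (subst (_∈ map f as) (sym eq) (∈-map⁺ f (Equivalence.from (∈as a) bp)))
  from (1F ∷ w) w∈ℙ with b , bp , eq ← ℙ-run {m} {suc n} (complement-ℙ {suc n} {suc m} w∈ℙ) =
    ∈-++⁺ʳ (map f as) (subst (_∈ map g bs)
      (trans (cong complement (sym eq)) (complement-involutive (1F ∷ w)))
      (∈-map⁺ g (Equivalence.from (∈bs b) bp)))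

-- The word of `n` zeros is the only candidate, and none of its factors contains a 1.
#ℙ-zero : ∀ n → #ℙ n 0 ≡ 1
#ℙ-zero n = #ℙ≡length n 0 ([] ∷ []) λ w → mk⇔
  (λ { (here refl) → zeros-ℙ }) (λ { (_ , _ , refl , ht) → here (all-zeros w ht) })
  where
  all-zeros : ∀ w → height w ≡ 0 → w ≡ replicate (length w) 0F
  all-zeros []       _  = refl
  all-zeros (0F ∷ w) ht = cong (0F ∷_) (all-zeros w ht)
  all-zeros (1F ∷ w) ()

  height-zeros : ∀ n → height (replicate n 0F) ≡ 0
  height-zeros zero    = refl
  height-zeros (suc n) = height-zeros n

  zeros-ℙ : ℙ n 0 (replicate n 0F)
  zeros-ℙ =
      By₁⇒Balanced (λ u⊑ _ _ → ≤-trans (Infix⇒∣∣₁≤ u⊑) (≤-trans (≤-reflexive (height-zeros n)) z≤n))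
    , reverse-zeros n
    , length-replicate n
    , height-zeros n
    where
    reverse-zeros : ∀ n → reverse (replicate n 0F) ≡ replicate n 0F
    reverse-zeros zero    = refl
    reverse-zeros (suc n) = trans (unfold-reverse 0F (replicate n 0F))
      (trans (cong (_∷ʳ 0F) (reverse-zeros n)) (replicate-∷ʳ n 0F))

-- Reduction modulo the length and the four cases.

-- With `m = h - 1`, this replaces `L - 1` by `L - h` in the second summand. At `m = 0` both sides
-- vanish since the second arguments are positive.
p-mod : ∀ m n → p (+ m) (+ suc (m + n)) ≡ p (+ m) (+ suc n)
p-mod zero    n = refl
p-mod (suc m) n = cong (#ℙ (suc m)) (trans
  (cong (λ k → suc k %ℕ suc m) (+-comm (suc m) n)) ([m+n]%n≡m%n (suc n) (suc m)))

theorem20 : (L h : ℤ) →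
    let Case₁ = L < 0ℤ ⊎ (L ≡ 0ℤ × h ≢ 0ℤ)
        Case₂ = L ≥ 0ℤ × (h ≡ 0ℤ ⊎ h ≡ L)
        Case₃ = L > 0ℤ × (h < 0ℤ ⊎ h > L)
    in (Case₁ → p L h ≡ 0)
     × (Case₂ → p L h ≡ 1)
     × ((c : Case₃) → p L h ≡ p L (+ (_%_ h L {{>-nonZero (proj₁ c)}})))
     × (¬ (Case₁ ⊎ Case₂ ⊎ Case₃) →
          p L h ≡ p (L - h - 1ℤ) h ℕ.+ p (h - 1ℤ) (L - 1ℤ))
theorem20 L h = case₁ L h , case₂ L h , case₃ L h , case₄ L h
  where
  case₁ : ∀ L h → L < 0ℤ ⊎ (L ≡ 0ℤ × h ≢ 0ℤ) → p L h ≡ 0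
  case₁ -[1+ _ ] h           _                    = refl
  case₁ _        (+ zero)    (inj₂ (refl , h≢0))  = contradiction refl h≢0
  case₁ _        (+ suc _)   (inj₂ (refl , h≢0))  = refl
  case₁ _        -[1+ _ ]    (inj₂ (refl , h≢0))  = refl
  case₁ (+ _)    h           (inj₁ (+<+ ()))

  case₂ : ∀ L h → L ≥ 0ℤ × (h ≡ 0ℤ ⊎ h ≡ L) → p L h ≡ 1
  case₂ (+ zero)  _ (_ , inj₁ refl) = refl
  case₂ (+ zero)  _ (_ , inj₂ refl) = refl
  case₂ (+ suc n) _ (_ , inj₁ refl) = #ℙ-zero (suc n)
  -- Reduction modulo `L` turns `h = L` into height 0.
  case₂ (+ suc n) _ (_ , inj₂ refl) = trans (cong (#ℙ (suc n)) (n%n≡0 (suc n))) (#ℙ-zero (suc n))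
  case₂ -[1+ _ ]  _ (() , _)

  case₃ : ∀ L h (c : L > 0ℤ × (h < 0ℤ ⊎ h > L)) →
          p L h ≡ p L (+ (_%_ h L {{>-nonZero (proj₁ c)}}))
  case₃ (+ zero)  h (+<+ () , _)
  case₃ -[1+ _ ]  h (() , _)
  -- The definition of `p` already reduces `h`, and reducing twice changes nothing.
  case₃ (+ suc n) h c = cong (#ℙ (suc n)) (sym (m<n⇒m%n≡m (n%ℕd<d h (suc n))))

  case₄ : ∀ L h → ¬ ((L < 0ℤ ⊎ (L ≡ 0ℤ × h ≢ 0ℤ)) ⊎ (L ≥ 0ℤ × (h ≡ 0ℤ ⊎ h ≡ L)) ⊎
                     (L > 0ℤ × (h < 0ℤ ⊎ h > L))) →
          p L h ≡ p (L - h - 1ℤ) h ℕ.+ p (h - 1ℤ) (L - 1ℤ)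
  case₄ -[1+ _ ]  h         ¬c = contradiction (inj₁ (inj₁ -<+)) ¬c
  case₄ (+ zero)  (+ zero)  ¬c = contradiction (inj₂ (inj₁ (+≤+ z≤n , inj₁ refl))) ¬c
  case₄ (+ zero)  (+ suc _) ¬c = contradiction (inj₁ (inj₂ (refl , λ ()))) ¬c
  case₄ (+ zero)  -[1+ _ ]  ¬c = contradiction (inj₁ (inj₂ (refl , λ ()))) ¬c
  case₄ (+ suc _) -[1+ _ ]  ¬c = contradiction (inj₂ (inj₂ (+<+ (s≤s z≤n) , inj₁ -<+))) ¬c
  case₄ (+ suc _) (+ zero)  ¬c = contradiction (inj₂ (inj₁ (+≤+ z≤n , inj₁ refl))) ¬c
  case₄ (+ suc l) (+ suc m) ¬c with <-cmp l m
  ... | tri< l<m _ _    = contradiction (inj₂ (inj₂ (+<+ (s≤s z≤n) , inj₂ (+<+ (s≤s l<m))))) ¬c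
  ... | tri≈ _ refl _   = contradiction (inj₂ (inj₁ (+≤+ z≤n , inj₂ refl))) ¬c
  -- Only `0 < h < L` remains: `h = m + 1`, `L = m + n + 2` and `n = L - h - 1`.
  ... | tri> _ _ m<l with n , refl ← m≤n⇒∃[o]m+o≡n m<l = begin
    #ℙ (suc (suc m + n)) (suc m %ℕ suc (suc m + n))
      ≡⟨ cong₂ #ℙ (cong suc (+-comm (suc m) n)) (m<n⇒m%n≡m (s≤s (s≤s (m≤m+n m n)))) ⟩
    #ℙ (suc n + suc m) (suc m)
      ≡⟨ #ℙ-recurrence n m ⟩
    p (+ n) (+ suc m) + p (+ m) (+ suc n)
      ≡⟨ cong₂ (λ L q → p L (+ suc m) + q) (cancel (+ m) (+ n)) (p-mod m n) ⟨
    p (+ suc (suc m + n) - + suc m - 1ℤ) (+ suc m) + p (+ m) (+ (suc m + n)) ∎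
    where
    open ≡-Reasoning
    cancel : ∀ m n → (+ 2 ℤ.+ m ℤ.+ n) - (1ℤ ℤ.+ m) - 1ℤ ≡ n
    cancel = ℤ-Solver.solve-∀
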